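{- For every integer $k\ge 1$, both the relations $\mathcal{P}_k$ and $\underline{\mathcal{P}_k}$ are regular.
   Context: $A$ is a finite alphabet with $|A|\ge 2$; $A^*$ is the free monoid over $A$ and $|w|$ is the length of $w$. For $w,w'\in A^*$, $w\wedge w'$ is their longest common prefix, and $(w,w')\in\mathcal{P}_k$ iff $|w|+|w'|-2|w\wedge w'|\le k$. $\underline{\mathcal{P}_k}=\mathcal{P}_k\setminus\{(w,w):w\in A^*\}$. A relation $\tau\subseteq A^*\times A^*$ is regular if it is a regular (rational) subset of the monoid $A^*\times A^*$, i.e. it belongs to the smallest family of subsets of $A^*\times A^*$ that contains the finite subsets and is closed under union, product and Kleene star (equivalently, it is the behavior of a finite automaton with transitions labeled by elements of $A^*\times A^*$). -}

module Defs where

open import Algebra.Bundles using (Monoid)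
open import Algebra.Construct.DirectProduct using () renaming (monoid to _×ᵐ_)
open import Data.Fin using (Fin)
open import Data.Fin.Properties using (inj⇒≟)
open import Data.List using (List; []; _∷_; length)
open import Data.List.Properties using (++-monoid)
open import Data.List.Relation.Binary.Prefix.Heterogeneous using (Prefix; []; _∷_)
open import Data.Nat using (ℕ; _+_; _*_; _∸_; _≤_; z≤n; s≤s)
open import Data.Product using (_×_; _,_; ∃; ∃₂; proj₁; uncurry)
open import Function using (_↔_)
open import Function.Properties.Inverse using (↔⇒↣)
open import Level using (Level; 0ℓ; _⊔_; suc)
open import Relation.Binary using (DecidableEquality)
open import Relation.Binary.PropositionalEquality using (_≡_; refl)
open import Relation.Nullary using (yes; no; contradiction)
open import Relation.Unary using (Pred; _∈_; _∪_; _≐_; _∖_)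

import Data.List.Membership.Setoid as SetoidMembership

module RegularSubsets {c ℓ : Level} (M : Monoid c ℓ) where
  open Monoid M
  open SetoidMembership setoid using () renaming (_∈_ to _∈ₗ_)

  Subset : Set (suc (c ⊔ ℓ))
  Subset = Pred Carrier (c ⊔ ℓ)

  infixl 7 _·_

  _·_ : Subset → Subset → Subset
  (X · Y) m = ∃₂ λ x y → x ∈ X × y ∈ Y × m ≈ x ∙ y

  data Star (X : Subset) : Subset where
    nil  : ∀ {m} → m ≈ ε → Star X m
    cons : ∀ {m x y} → x ∈ X → y ∈ Star X → m ≈ x ∙ y → Star X m

  -- Subsets are compared extensionally, so the family has to be closed under _≐_.
  data Regular : Subset → Set (suc (c ⊔ ℓ)) where
    finite  : (ms : List Carrier) → Regular (_∈ₗ ms)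
    union   : ∀ {X Y} → Regular X → Regular Y → Regular (X ∪ Y)
    product : ∀ {X Y} → Regular X → Regular Y → Regular (X · Y)
    star    : ∀ {X} → Regular X → Regular (Star X)
    resp    : ∀ {X Y} → X ≐ Y → Regular X → Regular Y

module _ (A : Set) where
  wordPairs : Monoid 0ℓ 0ℓ
  wordPairs = ++-monoid A ×ᵐ ++-monoid A

  RegularRelation : Pred (List A × List A) 0ℓ → Set₁
  RegularRelation = RegularSubsets.Regular wordPairs

module _ {A : Set} where
  IsLongestCommonPrefix : List A → List A → List A → Set
  IsLongestCommonPrefix w w′ p =
    Prefix _≡_ p w × Prefix _≡_ p w′ ×
    (∀ q → Prefix _≡_ q w → Prefix _≡_ q w′ → length q ≤ length p)

  longestCommonPrefix : DecidableEquality A → (w w′ : List A) →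
                        ∃ (IsLongestCommonPrefix w w′)
  longestCommonPrefix _≟_ [] w′ = [] , [] , [] , λ { _ [] _ → z≤n }
  longestCommonPrefix _≟_ (x ∷ w) [] = [] , [] , [] , λ { _ _ [] → z≤n }
  longestCommonPrefix _≟_ (x ∷ w) (y ∷ w′) with x ≟ y
  ... | no x≢y = [] , [] , [] , λ
    { _ [] _ → z≤n
    ; _ (refl ∷ _) (refl ∷ _) → contradiction refl x≢y
    }
  ... | yes refl with longestCommonPrefix _≟_ w w′
  ...   | p , p≤w , p≤w′ , longest = x ∷ p , refl ∷ p≤w , refl ∷ p≤w′ , λ
    { _ [] _ → z≤n
    ; _ (refl ∷ q≤w) (_ ∷ q≤w′) → s≤s (longest _ q≤w q≤w′)
    }

module PrefixRelations {A : Set} {n : ℕ} (A↔Fin : A ↔ Fin n) where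

  infixl 7 _∧_

  _∧_ : List A → List A → List A
  w ∧ w′ = proj₁ (longestCommonPrefix (inj⇒≟ (↔⇒↣ A↔Fin)) w w′)

  -- The truncated subtraction is exact: w ∧ w′ is a prefix of both words.
  𝒫 : ℕ → Pred (List A × List A) 0ℓ
  𝒫 k (w , w′) = length w + length w′ ∸ 2 * length (w ∧ w′) ≤ k

  𝒫-strict : ℕ → Pred (List A × List A) 0ℓ
  𝒫-strict k = 𝒫 k ∖ uncurry _≡_

{-# OPTIONS --safe #-}
-- 𝒫 k is the diagonal times the finite set of pairs (u , v) with |u| + |v| ≤ k:
-- split off the longest common prefix one way; conversely, any common prefix is
-- at most as long as the longest one. By left cancellation, the strict version
-- only removes the pairs (u , u) from the finite factor.
module Submission where

open import Defs
open import Algebra.Bundles using (Monoid)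
open import Algebra.Definitions.RawMagma using (_,_)
open import Data.Fin using (Fin)
open import Data.Fin.Properties using (inj⇒≟)
open import Data.List using (List; []; _∷_; _++_; length; map; filter; allFin; cartesianProduct; cartesianProductWith)
open import Data.List.Membership.Propositional using (_∈_)
open import Data.List.Membership.Propositional.Properties
  using (∈-map⁺; ∈-filter⁺; ∈-filter⁻; ∈-allFin; ∈-cartesianProduct⁺; ∈-cartesianProductWith⁺)
open import Data.List.Properties using (++-cancelˡ; length-++; ≡-dec)
open import Data.List.Relation.Binary.Prefix.Propositional.Properties using (Prefix-as-∣ˡ; ∣ˡ-as-Prefix)
import Data.List.Relation.Unary.Any as Any
open Any using (here; there)
open import Data.Nat using (ℕ; zero; suc; _+_; _*_; _∸_; _≤_; s≤s; _≤?_)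
open import Data.Nat.Properties
  using (≤-trans; ≤-reflexive; m≤m+n; m≤n+m; m+n∸m≡n; ∸-monoʳ-≤; *-monoʳ-≤)
open import Data.Nat.Tactic.RingSolver using (solve-∀)
open import Data.Product using (_×_; _,_; proj₁; proj₂; ∃; ∃₂; uncurry)
open import Function using (_↔_; Inverse; _∘_; id)
open import Function.Properties.Inverse using (↔⇒↣)
open import Level using (0ℓ)
open import Relation.Binary using (DecidableEquality)
open import Relation.Binary.PropositionalEquality using (_≡_; refl; trans; cong; cong₂; subst)
open import Relation.Nullary using (¬?)
open import Relation.Nullary.Decidable using (_×-dec_)
open import Relation.Unary using (Pred; Decidable; _⊆_; _∖_)

-- Both directions of the decomposition of `𝒫 k` rest on this count. Here `p` may be any common
-- prefix, and after regrouping `2 * length p` is a summand, so the truncated subtraction is exact.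
length-++-∸ : {A : Set} (p u v : List A) →
              length (p ++ u) + length (p ++ v) ∸ 2 * length p ≡ length u + length v
length-++-∸ p u v = trans
  (cong (_∸ 2 * length p) (trans (cong₂ _+_ (length-++ p) (length-++ p))
                                 (regroup (length p) (length u) (length v))))
  (m+n∸m≡n (2 * length p) _)
  where
  regroup : ∀ a b c → (a + b) + (a + c) ≡ 2 * a + (b + c)
  regroup = solve-∀

module _ {A : Set} where
  open RegularSubsets (wordPairs A)

  -- Membership in the generating lists is up to the componentwise equality of wordPairs.
  regular-enumerated : {P : Pred (List A × List A) 0ℓ} → Decidable P →
                       (ms : List (List A × List A)) → (∀ {m} → P m → m ∈ ms) → Regular P
  regular-enumerated P? ms P⊆ms = resp
    ( (λ m∈ → proj₂ (∈-filter⁻ P? {xs = ms} (Any.map (λ { (refl , refl) → refl }) m∈)))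
    , (λ Pm → Any.map (λ { refl → refl , refl }) (∈-filter⁺ P? (P⊆ms Pm) Pm)) )
    (finite (filter P? ms))

module _ {A : Set} {n : ℕ} (A↔Fin : A ↔ Fin n) where
  open RegularSubsets (wordPairs A)
  open PrefixRelations A↔Fin

  _≟_ : DecidableEquality A
  _≟_ = inj⇒≟ (↔⇒↣ A↔Fin)

  letters : List A
  letters = map (Inverse.from A↔Fin) (allFin n)

  ∈-letters : ∀ a → a ∈ letters
  ∈-letters a = subst (_∈ letters) (Inverse.strictlyInverseʳ A↔Fin a)
    (∈-map⁺ (Inverse.from A↔Fin) (∈-allFin (Inverse.to A↔Fin a)))

  wordsUpTo : ℕ → List (List A)
  wordsUpTo zero    = [] ∷ []
  -- Keeping `[]` at every level lets a word stop early, so lengths below the bound are listed too.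
  wordsUpTo (suc k) = [] ∷ cartesianProductWith _∷_ letters (wordsUpTo k)

  ∈-wordsUpTo : ∀ {k} w → length w ≤ k → w ∈ wordsUpTo k
  ∈-wordsUpTo {zero}  []      _         = here refl
  ∈-wordsUpTo {suc k} []      _         = here refl
  ∈-wordsUpTo {suc k} (a ∷ w) (s≤s w≤k) =
    there (∈-cartesianProductWith⁺ _∷_ (∈-letters a) (∈-wordsUpTo w w≤k))

  Short : ℕ → Pred (List A × List A) 0ℓ
  Short k (u , v) = length u + length v ≤ k

  -- A bound on the sum of the lengths bounds each length, so `P` lies inside a finite square of
  -- word lists. The square also holds pairs of total length above `k`; filtering by `P?` discards
  -- them.
  regular-bounded : ∀ {P} k → Decidable P → P ⊆ Short k → Regular P
  regular-bounded k P? P⊆Short =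
    regular-enumerated P? (cartesianProduct (wordsUpTo k) (wordsUpTo k)) λ {m} Pm →
      ∈-cartesianProduct⁺
        (∈-wordsUpTo (proj₁ m) (≤-trans (m≤m+n _ _) (P⊆Short Pm)))
        (∈-wordsUpTo (proj₂ m) (≤-trans (m≤n+m _ _) (P⊆Short Pm)))

  -- The diagonal is the submonoid generated by the pairs `double a`, and a finite alphabet gives
  -- finitely many of these.
  regular-diagonal : Regular (uncurry _≡_)
  regular-diagonal = resp ((λ {m} → sound {m}) , λ { {w , _} refl → complete w })
    (star (finite (map double letters)))
    where
    double : A → List A × List A
    double a = a ∷ [] , a ∷ []

    -- An arbitrary list `as` replaces `letters` so that the recursion can pass to the tail.
    generator-diagonal : ∀ {as m} → Any.Any (Monoid._≈_ (wordPairs A) m) (map double as) →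
                         uncurry _≡_ m
    generator-diagonal {_ ∷ _} (here (refl , refl)) = refl
    generator-diagonal {_ ∷ as} (there m∈)          = generator-diagonal {as} m∈

    sound : Star _ ⊆ uncurry _≡_
    sound (nil (refl , refl)) = refl
    sound (cons x∈ y∈ (refl , refl)) =
      cong₂ _++_ (generator-diagonal {letters} x∈) (sound y∈)

    complete : ∀ w → Star _ (w , w)
    complete []      = nil (refl , refl)
    complete (a ∷ w) = cons
      (Any.map (λ { refl → refl , refl }) (∈-map⁺ double (∈-letters a)))
      (complete w) (refl , refl)

  -- Since `u` and `v` may begin alike, `p` need not be the longest common prefix. The longest one
  -- is at least as long, so it subtracts at least as much and the bound persists.
  common-prefix⇒𝒫 : ∀ {k} p u v → Short k (u , v) → 𝒫 k (p ++ u , p ++ v)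
  common-prefix⇒𝒫 p u v short =
    let _ , _ , _ , longest = longestCommonPrefix _≟_ (p ++ u) (p ++ v)
    in ≤-trans
      (∸-monoʳ-≤ (length (p ++ u) + length (p ++ v))
        (*-monoʳ-≤ 2 (longest p (∣ˡ-as-Prefix (u , refl)) (∣ˡ-as-Prefix (v , refl)))))
      (≤-trans (≤-reflexive (length-++-∸ p u v)) short)

  𝒫⇒common-prefix : ∀ {k} w w′ → 𝒫 k (w , w′) →
                    ∃ λ p → ∃₂ λ u v → Short k (u , v) × w ≡ p ++ u × w′ ≡ p ++ v
  -- The witness is the longest common prefix itself; abstracting it here turns `close` into a bound
  -- in terms of `length p`.
  𝒫⇒common-prefix {k} w w′ close with longestCommonPrefix _≟_ w w′
  ... | p , p≤w , p≤w′ , _ with Prefix-as-∣ˡ p≤w | Prefix-as-∣ˡ p≤w′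
  ...   | u , refl | v , refl = p , u , v , subst (_≤ k) (length-++-∸ p u v) close , refl , refl

  short? : ∀ k → Decidable (Short k)
  short? k (u , v) = length u + length v ≤? k

  𝒫-regular : ∀ k → Regular (𝒫 k)
  𝒫-regular k = resp (to , λ {m} → from {m})
    (product regular-diagonal (regular-bounded k (short? k) id))
    where
    to : uncurry _≡_ · Short k ⊆ 𝒫 k
    to ((p , _) , (u , v) , refl , short , refl , refl) = common-prefix⇒𝒫 p u v short

    from : 𝒫 k ⊆ uncurry _≡_ · Short k
    from {w , w′} close with p , u , v , short , eqs ← 𝒫⇒common-prefix w w′ close =
      (p , p) , (u , v) , refl , short , eqs

  -- Regular relations are not closed under difference in general, so the diagonal is removed inside
  -- the finite factor, where any decidable condition preserves regularity.
  𝒫-strict-regular : ∀ k → Regular (𝒫-strict k)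
  𝒫-strict-regular k = resp (to , λ {m} → from {m})
    (product regular-diagonal (regular-bounded k strict? proj₁))
    where
    strict? : Decidable (Short k ∖ uncurry _≡_)
    strict? (u , v) = short? k (u , v) ×-dec ¬? (≡-dec _≟_ u v)

    to : uncurry _≡_ · (Short k ∖ uncurry _≡_) ⊆ 𝒫-strict k
    to ((p , _) , (u , v) , refl , (short , u≢v) , refl , refl) =
      common-prefix⇒𝒫 p u v short , u≢v ∘ ++-cancelˡ p u v

    from : 𝒫-strict k ⊆ uncurry _≡_ · (Short k ∖ uncurry _≡_)
    from {w , w′} (close , w≢w′) with 𝒫⇒common-prefix w w′ close
    ... | p , u , v , short , refl , refl =
      (p , p) , (u , v) , refl , (short , w≢w′ ∘ cong (p ++_)) , refl , refl

proposition3p8 : (A : Set) (n : ℕ) (A↔Fin : A ↔ Fin n) → 2 ≤ n →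
    (k : ℕ) → 1 ≤ k →
    RegularRelation A (PrefixRelations.𝒫 A↔Fin k) ×
    RegularRelation A (PrefixRelations.𝒫-strict A↔Fin k)
proposition3p8 A n A↔Fin _ k _ = 𝒫-regular A↔Fin k , 𝒫-strict-regular A↔Fin k
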